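{- Let $S$ be a list of sequences (indexed from $0$), and let $\rho(S[i],S[j])$ denote the length of the maximal common prefix of the sequences at indices $i$ and $j$. Define the overlap of $S[j]$ with respect to $S$ as $\mathcal{O}_S(j) := \max_{i<j} \rho(S[i],S[j])$ and the overlap of $S$ as $\mathcal{O}(S) := \sum_{j>0} \mathcal{O}_S(j)$. Let $L$ be the lexicographically ordered permutation of $S$. Then \[ \mathcal{O}(S) = \mathcal{O}(L) = \sum_{j>0} \rho(L[j-1],L[j]). \]
   Context: Setting: batch processing of shortest path queries in a road network. For each query, shortcut chains (sequences of vertices in a shortcut graph, oriented from the hub vertex to a query endpoint) are computed and then unpacked into paths; when unpacking a chain, the unpacked common prefix with a previously unpacked chain can be copied instead of recomputed. The overlap $\mathcal{O}(S)$ measures the amount of unpacking work saved for a given processing order of the list of chains $S$. -}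

module Defs where

open import Data.Fin.Base using (Fin; zero; suc; toℕ; inject)
open import Data.List.Base using (List; []; _∷_; length; lookup; map; tabulate; allFin)
open import Data.List.Extrema.Nat using (max)
open import Data.List.Relation.Binary.Lex.NonStrict using (≤-decTotalOrder)
open import Data.List.Relation.Binary.Prefix.Heterogeneous using (Prefix; []; _∷_)
import Data.List.Relation.Unary.Sorted.TotalOrder as SortedTotalOrder
open import Data.Nat.Base using (ℕ; zero; suc; _≤_; z≤n; s≤s)
open import Data.Nat.ListAction using (sum)
open import Level using (_⊔_)
open import Relation.Binary.Bundles using (DecTotalOrder)
open import Relation.Nullary.Decidable.Core using (yes; no)
open import Relation.Nullary.Negation.Core using (contradiction)

∑[j>0] : ∀ {n} → (Fin n → ℕ) → ℕ
∑[j>0] {zero}  f = 0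
∑[j>0] {suc n} f = sum (tabulate (λ j → f (suc j)))

module Overlap {a ℓ₁ ℓ₂} (O : DecTotalOrder a ℓ₁ ℓ₂) where

  open DecTotalOrder O using (Carrier; _≈_; _≟_; module Eq)

  Sequence : Set a
  Sequence = List Carrier

  commonPrefix : Sequence → Sequence → Sequence
  commonPrefix []       _        = []
  commonPrefix (_ ∷ _)  []       = []
  commonPrefix (x ∷ xs) (y ∷ ys) with x ≟ y
  ... | yes _ = x ∷ commonPrefix xs ys
  ... | no  _ = []

  ρ : Sequence → Sequence → ℕ
  ρ xs ys = length (commonPrefix xs ys)

  commonPrefix-prefixˡ : ∀ xs ys → Prefix _≈_ (commonPrefix xs ys) xs
  commonPrefix-prefixˡ []       _        = []
  commonPrefix-prefixˡ (_ ∷ _)  []       = []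
  commonPrefix-prefixˡ (x ∷ xs) (y ∷ ys) with x ≟ y
  ... | yes _ = Eq.refl ∷ commonPrefix-prefixˡ xs ys
  ... | no  _ = []

  commonPrefix-prefixʳ : ∀ xs ys → Prefix _≈_ (commonPrefix xs ys) ys
  commonPrefix-prefixʳ []       _        = []
  commonPrefix-prefixʳ (_ ∷ _)  []       = []
  commonPrefix-prefixʳ (x ∷ xs) (y ∷ ys) with x ≟ y
  ... | yes x≈y = x≈y ∷ commonPrefix-prefixʳ xs ys
  ... | no  _   = []

  commonPrefix-maximal : ∀ {zs} xs ys → Prefix _≈_ zs xs → Prefix _≈_ zs ys →
                         length zs ≤ ρ xs ys
  commonPrefix-maximal _        _        []       _        = z≤n
  commonPrefix-maximal (x ∷ xs) (y ∷ ys) (p ∷ ps) (q ∷ qs) with x ≟ y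
  ... | yes _   = s≤s (commonPrefix-maximal xs ys ps qs)
  ... | no  x≉y = contradiction (Eq.trans (Eq.sym p) q) x≉y

  -- inject {i = j} maps the indices below j (Fin (toℕ j)) into the indices of S.
  -- The base value 0 makes the empty maximum at j = 0 equal to 0; for j > 0 it
  -- has no effect, as ρ is ℕ-valued.
  overlapAt : (S : List Sequence) → Fin (length S) → ℕ
  overlapAt S j =
    max 0 (map (λ i → ρ (lookup S (inject {i = j} i)) (lookup S j)) (allFin (toℕ j)))

  totalOverlap : List Sequence → ℕ
  totalOverlap S = ∑[j>0] (overlapAt S)

  LexSorted : List Sequence → Set (a ⊔ ℓ₁ ⊔ ℓ₂)
  LexSorted = SortedTotalOrder.Sorted (DecTotalOrder.totalOrder (≤-decTotalOrder O))

{-# OPTIONS --safe #-}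

-- The common prefix length ρ satisfies the ultrametric inequality
-- ρ(x,y) ⊓ ρ(y,z) ≤ ρ(x,z).  If two consecutive sequences x, y overlap the
-- earlier ones by a and b, then among a, b and r = ρ(x,y) the two smallest are
-- equal, so a + (b ⊔ r) = b + (a ⊔ r): exchanging x and y does not change the
-- total overlap.  In a lexicographically sorted list x ≤ y ≤ z implies
-- ρ(x,z) ≤ ρ(y,z), so each maximum is attained at the immediate predecessor.
module Submission where

open import Defs
open import Data.Fin.Base using (Fin; zero; suc; pred; toℕ; inject)
open import Data.List.Base using (List; []; _∷_; lookup; map; tabulate; allFin)
open import Data.List.Extrema.Nat using (max; max≤v⁺; xs≤max; ⊥≤max)
open import Data.List.Properties using (map-tabulate; tabulate-cong)
open import Data.List.Relation.Binary.Lex using (this; next)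
open import Data.List.Relation.Binary.Lex.NonStrict using (≤-decTotalOrder)
open import Data.List.Relation.Binary.Permutation.Propositional using (_↭_; refl; prep; swap; trans; ↭-sym)
open import Data.List.Relation.Unary.All as All using (_∷_)
open import Data.List.Relation.Unary.Linked using ([-]; _∷_)
open import Data.Nat.Base using (ℕ; suc; _+_; _⊔_; _⊓_; _≤_; z≤n; s≤s)
open import Data.Nat.ListAction using (sum)
open import Data.Nat.Properties hiding (≤-decTotalOrder; _≟_)
open import Data.Product.Base using (_×_; _,_)
open import Data.Sum.Base using (inj₁; inj₂)
open import Function.Base using (_∘_; const)
open import Relation.Binary.Bundles using (DecTotalOrder)
open import Relation.Binary.PropositionalEquality using (_≡_; _≗_; refl; sym; cong; cong₂; module ≡-Reasoning) renaming (trans to ≡-trans)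
open import Relation.Nullary.Decidable.Core using (yes; no)
open import Relation.Nullary.Negation.Core using (contradiction)

-- Follows by antisymmetry from the least-upper-bound property of `max`, without unfolding its fold.
max-∷ : ∀ b x xs → max b (x ∷ xs) ≡ x ⊔ max b xs
max-∷ b x xs with xs≤max b (x ∷ xs)
... | x≤max ∷ xs≤max′ = ≤-antisym
  (max≤v⁺ (m≤n⇒m≤o⊔n x (⊥≤max b xs)) (m≤m⊔n x _ ∷ All.map (m≤n⇒m≤o⊔n x) (xs≤max b xs)))
  (⊔-lub x≤max (max≤v⁺ (⊥≤max b (x ∷ xs)) xs≤max′))

-- If `b ≤ r`, the second hypothesis forces `a ≡ b`. If `r ≤ b`, it gives `r ≤ a`, so both maxima
-- absorb `r`.
+-⊔-exchange-≤ : ∀ {a b r} → a ≤ b → b ⊓ r ≤ a → a + (b ⊔ r) ≡ b + (a ⊔ r)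
+-⊔-exchange-≤ {a} {b} {r} a≤b b⊓r≤a with ≤-total b r
... | inj₁ b≤r with refl ← ≤-antisym a≤b (≤-trans (⊓-glb ≤-refl b≤r) b⊓r≤a) = refl
... | inj₂ r≤b = begin
  a + (b ⊔ r) ≡⟨ cong (a +_) (m≥n⇒m⊔n≡m r≤b) ⟩
  a + b       ≡⟨ +-comm a b ⟩
  b + a       ≡⟨ cong (b +_) (m≥n⇒m⊔n≡m (≤-trans (⊓-glb r≤b ≤-refl) b⊓r≤a)) ⟨
  b + (a ⊔ r) ∎
  where open ≡-Reasoning

+-⊔-exchange : ∀ {a b r} → a ⊓ r ≤ b → b ⊓ r ≤ a → a + (b ⊔ r) ≡ b + (a ⊔ r)
+-⊔-exchange {a} {b} a⊓r≤b b⊓r≤a with ≤-total a b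
... | inj₁ a≤b = +-⊔-exchange-≤ a≤b b⊓r≤a
... | inj₂ b≤a = sym (+-⊔-exchange-≤ b≤a a⊓r≤b)

module _ {a ℓ₁ ℓ₂} (O : DecTotalOrder a ℓ₁ ℓ₂) where

  open Overlap O
  open DecTotalOrder O using (_≟_; module Eq; antisym; ≤-respʳ-≈)
  open DecTotalOrder (≤-decTotalOrder O) using () renaming (_≤_ to _≤ₗ_; trans to ≤ₗ-trans)

  ρ-sym : ∀ xs ys → ρ xs ys ≡ ρ ys xs
  ρ-sym []       []       = refl
  ρ-sym []       (_ ∷ _)  = refl
  ρ-sym (_ ∷ _)  []       = refl
  ρ-sym (x ∷ xs) (y ∷ ys) with x ≟ y | y ≟ x
  ... | yes _   | yes _   = cong suc (ρ-sym xs ys)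
  ... | no _    | no _    = refl
  ... | yes x≈y | no y≉x  = contradiction (Eq.sym x≈y) y≉x
  ... | no x≉y  | yes y≈x = contradiction (Eq.sym y≈x) x≉y

  -- Where `xs` and `zs` both still agree with `ys`, they agree with each other by transitivity of
  -- `≈`.
  ρ-ultrametric : ∀ xs ys zs → ρ xs ys ⊓ ρ ys zs ≤ ρ xs zs
  ρ-ultrametric []       _        _        = z≤n
  ρ-ultrametric (_ ∷ _)  []       _        = z≤n
  ρ-ultrametric (x ∷ xs) (y ∷ ys) []       = m⊓n≤n (ρ (x ∷ xs) (y ∷ ys)) 0
  ρ-ultrametric (x ∷ xs) (y ∷ ys) (z ∷ zs) with x ≟ y | y ≟ z | x ≟ z
  ... | yes _   | yes _   | yes _  = s≤s (ρ-ultrametric xs ys zs)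
  ... | yes x≈y | yes y≈z | no x≉z = contradiction (Eq.trans x≈y y≈z) x≉z
  ... | yes _   | no _    | _      = z≤n
  ... | no _    | _       | _      = z≤n

  -- When the heads of `xs` and `zs` agree, antisymmetry squeezes the head of `ys` into the same
  -- class, and the tails are again ordered. All other combinations of heads are contradictory or
  -- give 0 on the left.
  ρ-monoˡ-≤ₗ : ∀ {xs ys zs} → xs ≤ₗ ys → ys ≤ₗ zs → ρ xs zs ≤ ρ ys zs
  ρ-monoˡ-≤ₗ {[]}                         _ _ = z≤n
  ρ-monoˡ-≤ₗ {x ∷ _} {y ∷ _} {z ∷ _} x≤y y≤z with x ≟ z | y ≟ z
  ρ-monoˡ-≤ₗ _ _ | no _ | _ = z≤n
  ρ-monoˡ-≤ₗ (next _ xs≤ys) (next _ ys≤zs) | yes _ | yes _ = s≤s (ρ-monoˡ-≤ₗ xs≤ys ys≤zs)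
  ρ-monoˡ-≤ₗ _ (this (_ , y≉z)) | yes _ | yes y≈z = contradiction y≈z y≉z
  ρ-monoˡ-≤ₗ (this (_ , x≉y)) (next _ _) | yes x≈z | yes y≈z =
    contradiction (Eq.trans x≈z (Eq.sym y≈z)) x≉y
  ρ-monoˡ-≤ₗ _ (next y≈z _) | yes _ | no y≉z = contradiction y≈z y≉z
  ρ-monoˡ-≤ₗ (next x≈y _) (this _) | yes x≈z | no y≉z =
    contradiction (Eq.trans (Eq.sym x≈y) x≈z) y≉z
  ρ-monoˡ-≤ₗ (this (x≤y , x≉y)) (this (y≤z , _)) | yes x≈z | no y≉z =
    contradiction (antisym x≤y (≤-respʳ-≈ (Eq.sym x≈z) y≤z)) x≉y

  -- f x stands for the maximal overlap of x with the sequences processed before the list.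
  overlapAfter : (Sequence → ℕ) → List Sequence → ℕ
  overlapAfter f []       = 0
  overlapAfter f (x ∷ xs) = f x + overlapAfter (λ y → f y ⊔ ρ x y) xs

  overlapAt-∷ : ∀ x S j →
    overlapAt (x ∷ S) (suc j) ≡ ρ x (lookup S j) ⊔ overlapAt S j
  overlapAt-∷ x S j = begin
    max 0 (ρ x y ∷ map shifted (tabulate suc))  ≡⟨ max-∷ 0 _ (map shifted (tabulate suc)) ⟩
    ρ x y ⊔ max 0 (map shifted (tabulate suc))  ≡⟨ cong (λ ns → ρ x y ⊔ max 0 ns) eq ⟩
    ρ x y ⊔ overlapAt S j                       ∎
    where
    open ≡-Reasoning
    y = lookup S j

    shifted : Fin (suc (toℕ j)) → ℕ
    shifted i = ρ (lookup (x ∷ S) (inject {i = suc j} i)) y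

    -- `inject` and `lookup` compute on `suc`, so `shifted ∘ suc` is already the function maximised
    -- in `overlapAt S j`.
    eq : map shifted (tabulate suc) ≡ map (shifted ∘ suc) (allFin (toℕ j))
    eq = ≡-trans (map-tabulate suc shifted) (sym (map-tabulate _ (shifted ∘ suc)))

  -- A general `f` makes the induction go through: once `x` is passed, its overlaps `ρ x` are
  -- absorbed into `f`.
  sum-overlapAt : ∀ f S →
    sum (tabulate (λ j → f (lookup S j) ⊔ overlapAt S j)) ≡ overlapAfter f S
  sum-overlapAt f []      = refl
  sum-overlapAt f (x ∷ S) = cong₂ _+_ (⊔-identityʳ (f x)) (begin
    sum (tabulate (λ j → f (lookup S j) ⊔ overlapAt (x ∷ S) (suc j)))
      ≡⟨ cong sum (tabulate-cong step) ⟩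
    sum (tabulate (λ j → (f (lookup S j) ⊔ ρ x (lookup S j)) ⊔ overlapAt S j))
      ≡⟨ sum-overlapAt (λ y → f y ⊔ ρ x y) S ⟩
    overlapAfter (λ y → f y ⊔ ρ x y) S ∎)
    where
    open ≡-Reasoning
    step : ∀ j → f (lookup S j) ⊔ overlapAt (x ∷ S) (suc j)
                 ≡ (f (lookup S j) ⊔ ρ x (lookup S j)) ⊔ overlapAt S j
    step j = ≡-trans (cong (f (lookup S j) ⊔_) (overlapAt-∷ x S j))
                     (sym (⊔-assoc (f (lookup S j)) _ _))

  totalOverlap≡overlapAfter : ∀ S → totalOverlap S ≡ overlapAfter (const 0) S
  totalOverlap≡overlapAfter []      = refl
  -- `sum-overlapAt` also counts the index 0, whose term `0 ⊔ max 0 []` computes to 0.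
  totalOverlap≡overlapAfter (x ∷ S) = sum-overlapAt (const 0) (x ∷ S)

  overlapAfter-cong : ∀ {f g} → f ≗ g → ∀ S → overlapAfter f S ≡ overlapAfter g S
  overlapAfter-cong f≗g []      = refl
  overlapAfter-cong f≗g (x ∷ S) =
    cong₂ _+_ (f≗g x) (overlapAfter-cong (λ y → cong (_⊔ ρ x y) (f≗g y)) S)

  -- The invariant of the accumulated `f` that makes exchanges possible; for `f = ρ w` it is the
  -- ultrametric inequality of `ρ`.
  Ultrametric : (Sequence → ℕ) → Set a
  Ultrametric f = ∀ x y → f x ⊓ ρ x y ≤ f y

  ⊔-ultrametric : ∀ {f} → Ultrametric f → ∀ x → Ultrametric (λ y → f y ⊔ ρ x y)
  ⊔-ultrametric {f} f-ultra x y z = begin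
    (f y ⊔ ρ x y) ⊓ ρ y z           ≡⟨ ⊓-distribʳ-⊔ (ρ y z) (f y) (ρ x y) ⟩
    (f y ⊓ ρ y z) ⊔ (ρ x y ⊓ ρ y z) ≤⟨ ⊔-mono-≤ (f-ultra y z) (ρ-ultrametric x y z) ⟩
    f z ⊔ ρ x z                     ∎
    where open ≤-Reasoning

  overlapAfter-swap : ∀ {f} → Ultrametric f → ∀ x y S →
    overlapAfter f (x ∷ y ∷ S) ≡ overlapAfter f (y ∷ x ∷ S)
  overlapAfter-swap {f} f-ultra x y S = begin
    f x + ((f y ⊔ ρ x y) + overlapAfter (λ z → (f z ⊔ ρ x z) ⊔ ρ y z) S)
      ≡⟨ +-assoc (f x) _ _ ⟨
    f x + (f y ⊔ ρ x y) + overlapAfter (λ z → (f z ⊔ ρ x z) ⊔ ρ y z) S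
      ≡⟨ cong₂ _+_ heads (overlapAfter-cong tails S) ⟩
    f y + (f x ⊔ ρ y x) + overlapAfter (λ z → (f z ⊔ ρ y z) ⊔ ρ x z) S
      ≡⟨ +-assoc (f y) _ _ ⟩
    f y + ((f x ⊔ ρ y x) + overlapAfter (λ z → (f z ⊔ ρ y z) ⊔ ρ x z) S) ∎
    where
    open ≡-Reasoning
    -- The invariant from `x` to `y` and from `y` to `x` supplies the two hypotheses of
    -- `+-⊔-exchange`, with `r = ρ x y`.
    heads : f x + (f y ⊔ ρ x y) ≡ f y + (f x ⊔ ρ y x)
    heads rewrite ρ-sym y x =
      +-⊔-exchange (f-ultra x y) (≤-trans (≤-reflexive (cong (f y ⊓_) (ρ-sym x y))) (f-ultra y x))

    tails : ∀ z → (f z ⊔ ρ x z) ⊔ ρ y z ≡ (f z ⊔ ρ y z) ⊔ ρ x z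
    tails z = ≡-trans (⊔-assoc (f z) _ _)
      (≡-trans (cong (f z ⊔_) (⊔-comm (ρ x z) (ρ y z))) (sym (⊔-assoc (f z) _ _)))

  overlapAfter-↭ : ∀ {f S T} → Ultrametric f → S ↭ T → overlapAfter f S ≡ overlapAfter f T
  overlapAfter-↭ f-ultra refl = refl
  overlapAfter-↭ {f} f-ultra (prep x S↭T) =
    cong (f x +_) (overlapAfter-↭ (⊔-ultrametric f-ultra x) S↭T)
  overlapAfter-↭ {f} {x ∷ y ∷ S} {T = _ ∷ _ ∷ T} f-ultra (swap x y S↭T) = ≡-trans
    (cong (λ n → f x + ((f y ⊔ ρ x y) + n))
      (overlapAfter-↭ (⊔-ultrametric (⊔-ultrametric f-ultra x) y) S↭T))
    (overlapAfter-swap f-ultra x y T)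
  overlapAfter-↭ f-ultra (trans S↭T T↭U) =
    ≡-trans (overlapAfter-↭ f-ultra S↭T) (overlapAfter-↭ f-ultra T↭U)

  consecutiveOverlap : List Sequence → ℕ
  consecutiveOverlap S = ∑[j>0] (λ j → ρ (lookup S (pred j)) (lookup S j))

  -- The hypothesis on `f` says that, for every sequence above `x`, no earlier sequence overlaps it
  -- more than `x` does.
  overlapAfter-sorted : ∀ f {x L} → (∀ {z} → x ≤ₗ z → f z ≤ ρ x z) → LexSorted (x ∷ L) →
    overlapAfter (λ y → f y ⊔ ρ x y) L ≡ consecutiveOverlap (x ∷ L)
  overlapAfter-sorted f f≤ρ [-] = refl
  overlapAfter-sorted f {x} f≤ρ (x≤y ∷ sorted) = cong₂ _+_
    (m≤n⇒m⊔n≡n (f≤ρ x≤y))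
    (overlapAfter-sorted (λ y → f y ⊔ ρ x y)
      -- The bound passes from `x` to `y` along `f z ≤ ρ x z ≤ ρ y z`.
      (λ y≤z → ⊔-lub (≤-trans (f≤ρ (≤ₗ-trans x≤y y≤z)) (ρ-monoˡ-≤ₗ x≤y y≤z)) (ρ-monoˡ-≤ₗ x≤y y≤z))
      sorted)

  totalOverlap-↭ : ∀ {S T} → S ↭ T → totalOverlap S ≡ totalOverlap T
  totalOverlap-↭ {S} {T} S↭T = begin
    totalOverlap S           ≡⟨ totalOverlap≡overlapAfter S ⟩
    overlapAfter (const 0) S ≡⟨ overlapAfter-↭ (λ _ _ → z≤n) S↭T ⟩
    overlapAfter (const 0) T ≡⟨ totalOverlap≡overlapAfter T ⟨
    totalOverlap T           ∎
    where open ≡-Reasoning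

  totalOverlap-sorted : ∀ {L} → LexSorted L → totalOverlap L ≡ consecutiveOverlap L
  totalOverlap-sorted {[]}    _      = refl
  totalOverlap-sorted {x ∷ L} sorted =
    ≡-trans (totalOverlap≡overlapAfter (x ∷ L)) (overlapAfter-sorted (const 0) (λ _ → z≤n) sorted)

theorem8p1 : ∀ {a ℓ₁ ℓ₂} (O : DecTotalOrder a ℓ₁ ℓ₂) →
    let open Overlap O in
    (S L : List Sequence) → L ↭ S → LexSorted L →
    totalOverlap S ≡ totalOverlap L ×
    totalOverlap L ≡ ∑[j>0] (λ j → ρ (lookup L (pred j)) (lookup L j))
theorem8p1 O S L L↭S sorted = totalOverlap-↭ O (↭-sym L↭S) , totalOverlap-sorted O sorted
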